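{- Let $H$ be a hypergraph in which every edge contains at least $k$ vertices and meets at most $d$ other edges. Let $t\geqslant 2$ and $s\geqslant 1$ be two integers with $k\geqslant st$. If $$ e\sum_{j=0}^{s-1}\binom{k}{j}\left(\frac{1}{t}\right)^{j}\left(1-\frac{1}{t}\right)^{k-j}\Big((d+1)(t-1)+1\Big)\leqslant 1, $$ then $H$ has a $(t,s)$-coloring.
   Context: A hypergraph $H$ consists of a collection $\mathcal{E}$ of subsets of a finite set $V$; the members of $V$ are the vertices and the members of $\mathcal{E}$ are the edges of $H$. Here $k$ and $d$ are nonnegative integers. Two edges $f,g$ meet if $f\cap g\neq\emptyset$. For integers $t\geqslant 2$ and $s\geqslant 1$, a $(t,s)$-coloring of $H$ is a coloring of its vertices using $t$ colors (i.e. a map $V\to\{1,\ldots,t\}$) such that each color appears on each edge at least $s$ times, i.e. every edge contains at least $s$ vertices of each of the $t$ colors. The symbol $e$ denotes the base of the natural logarithm. In the displayed inequality, the left-hand side is the product of $e$, the sum $\sum_{j=0}^{s-1}\binom{k}{j}(1/t)^{j}(1-1/t)^{k-j}$, and the factor $(d+1)(t-1)+1$. -}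

module Defs where

open import Data.Bool.Properties using () renaming (_≟_ to _≟ᵇ_)
open import Data.Fin using (Fin; toℕ)
import Data.Fin.Properties as Fin
open import Data.Fin.Subset using (Subset; Nonempty; _∩_; ∣_∣)
open import Data.Fin.Subset.Properties using (nonempty?)
open import Data.Integer as ℤ using (+_)
open import Data.List using (List; filter; length)
open import Data.List.Membership.Propositional using (_∈_)
open import Data.List.Relation.Unary.Unique.Propositional using (Unique)
open import Data.Nat as ℕ using (ℕ; zero; suc; _∸_; _!; NonZero)
open import Data.Nat.Combinatorics using (_C_)
import Data.Nat.Properties as ℕ
open import Data.Product using (∃-syntax; _×_; _,_)
open import Data.Rational as ℚ
  using (ℚ; mkℚ; 0ℚ; 1ℚ; _+_; _-_; -_; _*_; _/_; _≤_; _<_; toℚᵘ; Positive; 1/_)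
  renaming (∣_∣ to abs)
open import Data.Rational.Properties
import Data.Rational.Unnormalised as ℚᵘ
import Data.Rational.Unnormalised.Properties as ℚᵘ
open import Data.Sum using (inj₁; inj₂)
open import Data.Vec using (tabulate)
open import Data.Vec.Properties using (≡-dec)
open import Relation.Binary.PropositionalEquality
  using (_≡_; _≢_; refl; sym; trans; cong; cong₂; subst; module ≡-Reasoning)
open import Relation.Nullary using (Dec; does; ¬?; _×-dec_)

open import Algebra.Properties.AbelianGroup +-0-abelianGroup
  using (xyx⁻¹≈y; ⁻¹-anti-homo-//; //-rightDividesˡ; \\-leftDividesʳ)
open import Algebra.Definitions.RawSemiring ℚ.+-*-rawSemiring using (_^_; sum)

private
  variable
    n t : ℕ

-- The collection of edges is a set of subsets, hence the uniqueness condition.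
record Hypergraph (n : ℕ) : Set where
  field
    edges  : List (Subset n)
    unique : Unique edges

open Hypergraph public

Meet : Subset n → Subset n → Set
Meet f g = Nonempty (f ∩ g)

OtherMeeting : Subset n → Subset n → Set
OtherMeeting f g = g ≢ f × Meet f g

otherMeeting? : (f g : Subset n) → Dec (OtherMeeting f g)
otherMeeting? f g = ¬? (≡-dec _≟ᵇ_ g f) ×-dec nonempty? (f ∩ g)

otherMeetingCount : Hypergraph n → Subset n → ℕ
otherMeetingCount H f = length (filter (otherMeeting? f) (edges H))

Coloring : ℕ → ℕ → Set
Coloring n t = Fin n → Fin t

colorClass : Coloring n t → Fin t → Subset n
colorClass χ c = tabulate (λ v → does (χ v Fin.≟ c))

IsColoring : Hypergraph n → (t s : ℕ) → Coloring n t → Set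
IsColoring H t s χ = ∀ f → f ∈ edges H → ∀ c → s ℕ.≤ ∣ f ∩ colorClass χ c ∣

record ℝ : Set where
  field
    seq    : ℕ → ℚ
    cauchy : ∀ ε → 0ℚ < ε → ∃[ N ] ∀ m n → N ℕ.≤ m → N ℕ.≤ n →
             abs (seq m - seq n) ≤ ε

open ℝ public

infix 4 _≤ℝ_
_≤ℝ_ : ℝ → ℝ → Set
x ≤ℝ y = ∀ ε → 0ℚ < ε → ∃[ N ] ∀ n → N ℕ.≤ n → seq x n ≤ seq y n + ε

fromℚ : ℚ → ℝ
fromℚ p .seq _ = p
fromℚ p .cauchy ε 0<ε = 0 , λ _ _ _ _ →
  ≤-trans (≤-reflexive (cong abs (+-inverseʳ p))) (<⇒≤ 0<ε)

private
  eventuallyBounded : (x : ℝ) →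
    ∃[ N ] ∃[ B ] 0ℚ < B × (∀ n → N ℕ.≤ n → abs (seq x n) ≤ B)
  eventuallyBounded x with cauchy x 1ℚ (positive⁻¹ 1ℚ)
  ... | N , close = N , 1ℚ + abs (seq x N) ,
    +-mono-<-≤ (positive⁻¹ 1ℚ) (0≤∣p∣ (seq x N)) , λ n N≤n → begin
      abs (seq x n)                            ≡⟨ cong abs (//-rightDividesˡ (seq x N) (seq x n)) ⟨
      abs ((seq x n - seq x N) + seq x N)      ≤⟨ ∣p+q∣≤∣p∣+∣q∣ (seq x n - seq x N) (seq x N) ⟩
      abs (seq x n - seq x N) + abs (seq x N)  ≤⟨ +-monoˡ-≤ (abs (seq x N)) (close n N N≤n ℕ.≤-refl) ⟩
      1ℚ + abs (seq x N)                       ∎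
    where open ≤-Reasoning

  abs-*-mono : ∀ {p q P Q} → 0ℚ ≤ P → abs p ≤ P → abs q ≤ Q → abs (p * q) ≤ P * Q
  abs-*-mono {p} {q} {P} {Q} 0≤P p≤P q≤Q = begin
    abs (p * q)    ≡⟨ ∣p*q∣≡∣p∣*∣q∣ p q ⟩
    abs p * abs q  ≤⟨ *-monoʳ-≤-nonNeg (abs q) {{∣-∣-nonNeg q}} p≤P ⟩
    P * abs q      ≤⟨ *-monoˡ-≤-nonNeg P {{ℚ.nonNegative 0≤P}} q≤Q ⟩
    P * Q          ∎
    where open ≤-Reasoning

  *-difference : ∀ a a′ b b′ → a * b - a′ * b′ ≡ a * (b - b′) + (a - a′) * b′
  *-difference a a′ b b′ = sym (begin
    a * (b - b′) + (a - a′) * b′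
      ≡⟨ cong₂ _+_ (*-distribˡ-+ a b (- b′)) (*-distribʳ-+ b′ a (- a′)) ⟩
    (a * b + a * (- b′)) + (a * b′ + (- a′) * b′)
      ≡⟨ cong₂ (λ u v → (a * b + u) + (a * b′ + v))
           (sym (neg-distribʳ-* a b′)) (sym (neg-distribˡ-* a′ b′)) ⟩
    (a * b - a * b′) + (a * b′ - a′ * b′)
      ≡⟨ +-assoc (a * b) (- (a * b′)) (a * b′ - a′ * b′) ⟩
    a * b + (- (a * b′) + (a * b′ - a′ * b′))
      ≡⟨ cong (_+_ (a * b)) (\\-leftDividesʳ (a * b′) (- (a′ * b′))) ⟩
    a * b - a′ * b′ ∎)
    where open ≡-Reasoning

  *-close : ∀ {a a′ b b′ B D δ} → 0ℚ ≤ B → 0ℚ ≤ δ → abs a ≤ B → abs b′ ≤ D →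
            abs (a - a′) ≤ δ → abs (b - b′) ≤ δ → abs (a * b - a′ * b′) ≤ B * δ + δ * D
  *-close {a} {a′} {b} {b′} {B} {D} {δ} 0≤B 0≤δ a≤B b′≤D a≈a′ b≈b′ = begin
    abs (a * b - a′ * b′)                     ≡⟨ cong abs (*-difference a a′ b b′) ⟩
    abs (a * (b - b′) + (a - a′) * b′)        ≤⟨ ∣p+q∣≤∣p∣+∣q∣ (a * (b - b′)) ((a - a′) * b′) ⟩
    abs (a * (b - b′)) + abs ((a - a′) * b′)  ≤⟨ +-mono-≤
      (abs-*-mono {a} {b - b′} 0≤B a≤B b≈b′) (abs-*-mono {a - a′} {b′} 0≤δ a≈a′ b′≤D) ⟩
    B * δ + δ * D                             ∎
    where open ≤-Reasoning

  tolerance : ∀ B D ε → 0ℚ < B → 0ℚ < D → 0ℚ < ε →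
              ∃[ δ ] 0ℚ < δ × B * δ + δ * D ≡ ε
  tolerance B D ε 0<B 0<D 0<ε = δ , 0<δ , Bδ+δD≡ε
    where
    instance
      B+D>0 : Positive (B + D)
      B+D>0 = ℚ.positive (+-mono-< 0<B 0<D)
      ε>0 : Positive ε
      ε>0 = ℚ.positive 0<ε
      B+D≢0 : ℚ.NonZero (B + D)
      B+D≢0 = pos⇒nonZero (B + D)
      1/[B+D]>0 : Positive (1/ (B + D))
      1/[B+D]>0 = 1/pos⇒pos (B + D)
    δ : ℚ
    δ = 1/ (B + D) * ε
    0<δ : 0ℚ < δ
    0<δ = positive⁻¹ δ {{pos*pos⇒pos (1/ (B + D)) ε}}
    Bδ+δD≡ε : B * δ + δ * D ≡ ε
    Bδ+δD≡ε = begin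
      B * δ + δ * D              ≡⟨ cong (_+_ (B * δ)) (*-comm δ D) ⟩
      B * δ + D * δ              ≡⟨ *-distribʳ-+ δ B D ⟨
      (B + D) * (1/ (B + D) * ε) ≡⟨ *-assoc (B + D) (1/ (B + D)) ε ⟨
      ((B + D) * 1/ (B + D)) * ε ≡⟨ cong (_* ε) (*-inverseʳ (B + D)) ⟩
      1ℚ * ε                     ≡⟨ *-identityˡ ε ⟩
      ε                          ∎
      where open ≡-Reasoning

  *-cauchy : ∀ x y ε → 0ℚ < ε → ∃[ N ] ∀ m n → N ℕ.≤ m → N ℕ.≤ n →
             abs (seq x m * seq y m - seq x n * seq y n) ≤ ε
  *-cauchy x y ε 0<ε =
    let
      N₁ , B , 0<B , x≤B = eventuallyBounded x
      N₂ , D , 0<D , y≤D = eventuallyBounded y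
      δ , 0<δ , Bδ+δD≡ε  = tolerance B D ε 0<B 0<D 0<ε
      N₃ , x-close       = cauchy x δ 0<δ
      N₄ , y-close       = cauchy y δ 0<δ
    in (N₁ ℕ.⊔ N₂) ℕ.⊔ (N₃ ℕ.⊔ N₄) , λ m n N≤m N≤n →
      let
        N₁₂≤m = ℕ.m⊔n≤o⇒m≤o (N₁ ℕ.⊔ N₂) (N₃ ℕ.⊔ N₄) N≤m
        N₁₂≤n = ℕ.m⊔n≤o⇒m≤o (N₁ ℕ.⊔ N₂) (N₃ ℕ.⊔ N₄) N≤n
        N₃₄≤m = ℕ.m⊔n≤o⇒n≤o (N₁ ℕ.⊔ N₂) (N₃ ℕ.⊔ N₄) N≤m
        N₃₄≤n = ℕ.m⊔n≤o⇒n≤o (N₁ ℕ.⊔ N₂) (N₃ ℕ.⊔ N₄) N≤n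
      in ≤-trans
        (*-close {seq x m} {seq x n} {seq y m} {seq y n} (<⇒≤ 0<B) (<⇒≤ 0<δ)
          (x≤B m (ℕ.m⊔n≤o⇒m≤o N₁ N₂ N₁₂≤m)) (y≤D n (ℕ.m⊔n≤o⇒n≤o N₁ N₂ N₁₂≤n))
          (x-close m n (ℕ.m⊔n≤o⇒m≤o N₃ N₄ N₃₄≤m) (ℕ.m⊔n≤o⇒m≤o N₃ N₄ N₃₄≤n))
          (y-close m n (ℕ.m⊔n≤o⇒n≤o N₃ N₄ N₃₄≤m) (ℕ.m⊔n≤o⇒n≤o N₃ N₄ N₃₄≤n)))
        (≤-reflexive Bδ+δD≡ε)

infixl 7 _*ℝ_
_*ℝ_ : ℝ → ℝ → ℝ
(x *ℝ y) .seq n  = seq x n * seq y n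
(x *ℝ y) .cauchy = *-cauchy x y

1/! : ℕ → ℚ
1/! i = _/_ (+ 1) (i !) {{i ℕ.!≢0}}

-- e is taken as the limit of the partial sums Σ_{i ≤ m} 1/i!.
expSum : ℕ → ℚ
expSum zero    = 1/! 0
expSum (suc m) = expSum m + 1/! (suc m)

private
  1/-pos : ∀ a .{{_ : NonZero a}} → 0ℚ ≤ + 1 / a
  1/-pos a = nonNegative⁻¹ (+ 1 / a) {{normalize-nonNeg 1 a}}

  toℚᵘ-1/ : ∀ a → toℚᵘ (+ 1 / suc a) ℚᵘ.≃ ℚᵘ.mkℚᵘ (+ 1) a
  toℚᵘ-1/ a = toℚᵘ-fromℚᵘ (ℚᵘ.mkℚᵘ (+ 1) a)

  1/-double : ∀ a c .{{_ : NonZero a}} .{{_ : NonZero c}} →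
              2 ℕ.* c ℕ.≤ a → + 1 / a + + 1 / a ≤ + 1 / c
  1/-double (suc a) (suc c) 2c≤a = toℚᵘ-cancel-≤ (begin
    toℚᵘ (+ 1 / suc a + + 1 / suc a)
      ≃⟨ toℚᵘ-homo-+ (+ 1 / suc a) (+ 1 / suc a) ⟩
    toℚᵘ (+ 1 / suc a) ℚᵘ.+ toℚᵘ (+ 1 / suc a)
      ≃⟨ ℚᵘ.+-cong (toℚᵘ-1/ a) (toℚᵘ-1/ a) ⟩
    ℚᵘ.mkℚᵘ (+ 1) a ℚᵘ.+ ℚᵘ.mkℚᵘ (+ 1) a
      ≤⟨ ℚᵘ.*≤* (ℤ.+≤+ lemma) ⟩
    ℚᵘ.mkℚᵘ (+ 1) c
      ≃⟨ toℚᵘ-1/ c ⟨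
    toℚᵘ (+ 1 / suc c) ∎)
    where
    open ℚᵘ.≤-Reasoning
    A = suc a
    lemma : ((1 ℕ.* A) ℕ.+ (1 ℕ.* A)) ℕ.* suc c ℕ.≤ 1 ℕ.* (A ℕ.* A)
    lemma = ℕ.≤-trans (ℕ.≤-reflexive (trans
        (cong (λ z → (z ℕ.+ z) ℕ.* suc c) (ℕ.*-identityˡ A))
        (trans (cong (ℕ._* suc c) (sym (trans (ℕ.*-distribˡ-+ A 1 1)
                 (cong₂ ℕ._+_ (ℕ.*-identityʳ A) (ℕ.*-identityʳ A)))))
          (ℕ.*-assoc A 2 (suc c)))))
      (ℕ.≤-trans (ℕ.*-monoʳ-≤ A 2c≤a) (ℕ.≤-reflexive (sym (ℕ.*-identityˡ (A ℕ.* A)))))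

  1/-archimedean : ∀ ε → 0ℚ < ε → ∃[ N ] ∀ a .{{_ : NonZero a}} → N ℕ.≤ a → + 1 / a ≤ ε
  1/-archimedean ε@(mkℚ (+ suc p) q _) _ = suc q , λ where
    (suc a) q≤a → toℚᵘ-cancel-≤ (ℚᵘ.≤-respˡ-≃ (ℚᵘ.≃-sym (toℚᵘ-1/ a))
      (ℚᵘ.*≤* (ℤ.+≤+ (ℕ.≤-trans (ℕ.≤-reflexive (ℕ.*-identityˡ (suc q)))
        (ℕ.≤-trans q≤a (ℕ.m≤n*m (suc a) (suc p)))))))
  1/-archimedean (mkℚ (+ zero) _ _)   0<ε with () ← ℚ.positive 0<ε
  1/-archimedean (mkℚ ℤ.-[1+ _ ] _ _) 0<ε with () ← ℚ.positive 0<ε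

  1/suc!-double : ∀ m → 1 ℕ.≤ m → 1/! (suc m) + 1/! (suc m) ≤ 1/! m
  1/suc!-double m 1≤m = 1/-double (suc m !) (m !) {{suc m ℕ.!≢0}} {{m ℕ.!≢0}}
    (ℕ.*-monoˡ-≤ (m !) (ℕ.s≤s 1≤m))

  expSum-lower : ∀ m j → expSum m ≤ expSum (j ℕ.+ m)
  expSum-lower m zero    = ≤-refl
  expSum-lower m (suc j) = ≤-trans (expSum-lower m j) (≤-trans
    (≤-reflexive (sym (+-identityʳ _)))
    (+-monoʳ-≤ (expSum (j ℕ.+ m)) (1/-pos _ {{suc (j ℕ.+ m) ℕ.!≢0}})))

  expSum-upper : ∀ m j → 1 ℕ.≤ m →
    expSum (j ℕ.+ m) + 1/! (j ℕ.+ m) ≤ expSum m + 1/! m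
  expSum-upper m zero    1≤m = ≤-refl
  expSum-upper m (suc j) 1≤m = ≤-trans
    (≤-reflexive (+-assoc (expSum (j ℕ.+ m)) (1/! (suc (j ℕ.+ m))) (1/! (suc (j ℕ.+ m)))))
    (≤-trans
      (+-monoʳ-≤ (expSum (j ℕ.+ m)) (1/suc!-double (j ℕ.+ m) (ℕ.≤-trans 1≤m (ℕ.m≤n+m m j))))
      (expSum-upper m j 1≤m))

  expSum-window : ∀ N m → 1 ℕ.≤ N → N ℕ.≤ m →
    expSum N ≤ expSum m × expSum m ≤ expSum N + 1/! N
  expSum-window N m 1≤N N≤m = subst
    (λ i → expSum N ≤ expSum i × expSum i ≤ expSum N + 1/! N)
    (ℕ.m∸n+n≡m N≤m)
    (expSum-lower N j , ≤-trans
      (≤-trans (≤-reflexive (sym (+-identityʳ _)))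
        (+-monoʳ-≤ (expSum (j ℕ.+ N)) (1/-pos _ {{(j ℕ.+ N) ℕ.!≢0}})))
      (expSum-upper N j 1≤N))
    where j = m ∸ N

  difference-≤ : ∀ {l p q ε} → l ≤ q → p ≤ l + ε → p - q ≤ ε
  difference-≤ {l} {p} {q} {ε} l≤q p≤l+ε = begin
    p - q        ≤⟨ +-mono-≤ p≤l+ε (neg-antimono-≤ l≤q) ⟩
    (l + ε) - l  ≡⟨ xyx⁻¹≈y l ε ⟩
    ε            ∎
    where open ≤-Reasoning

  window-close : ∀ {l p q ε} → l ≤ p × p ≤ l + ε → l ≤ q × q ≤ l + ε → abs (p - q) ≤ ε
  window-close {l} {p} {q} {ε} (l≤p , p≤) (l≤q , q≤) with ∣p∣≡p∨∣p∣≡-p (p - q)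
  ... | inj₁ eq = ≤-trans (≤-reflexive eq) (difference-≤ {l} {p} {q} l≤q p≤)
  ... | inj₂ eq = ≤-trans
    (≤-reflexive (trans eq (⁻¹-anti-homo-// p q)))
    (difference-≤ {l} {q} {p} l≤p q≤)

  n≤n! : ∀ m → m ℕ.≤ m !
  n≤n! zero    = ℕ.z≤n
  n≤n! (suc m) = ℕ.m≤m*n (suc m) (m !) {{m ℕ.!≢0}}

e : ℝ
e .seq = expSum
e .cauchy ε 0<ε with 1/-archimedean ε 0<ε
... | N , small = suc N , λ m n N<m N<n → ≤-trans
  (window-close {expSum (suc N)}
    (expSum-window (suc N) m (ℕ.s≤s ℕ.z≤n) N<m)
    (expSum-window (suc N) n (ℕ.s≤s ℕ.z≤n) N<n))
  (small (suc N !) {{suc N ℕ.!≢0}} (ℕ.≤-trans (ℕ.n≤1+n N) (n≤n! (suc N))))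

fromℕ : ℕ → ℚ
fromℕ m = + m / 1

-- The exponent k ∸ j is truncated only when j > k, and then k C j is 0.
binomialTail : (k s t : ℕ) .{{_ : NonZero t}} → ℚ
binomialTail k s t = sum {s} λ j →
  fromℕ (k C toℕ j) * (+ 1 / t) ^ toℕ j * (1ℚ - + 1 / t) ^ (k ∸ toℕ j)

module Submission where

-- Color the vertices uniformly at random and apply the lopsided local lemma to the
-- events "f has fewer than s vertices of color c".  Conditioning on other edges having
-- enough vertices of the same color c, or on edges disjoint from f, can only decrease the
-- probability of such an event (Harris' inequality on the vertices of f), so it conflicts
-- only with the events (g , c′) where g meets f and c′ ≢ c; there are at most
-- D = (d + 1) * (t ∸ 1) of them.  All probabilities are counts of colorings in ℕ.
-- The constant e enters through (1 + 1/D) ^ D ≤ Σ_{i ≤ D} 1/i!.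

open import Defs

-- Truncated binomial sums in ℕ.

module BinomialSums where

  open import Data.Bool using (true; false)
  open import Data.Nat
  open import Data.Nat.Combinatorics
  open import Data.Nat.Combinatorics.Base using (_P′_)
  open import Data.Nat.DivMod using (_/_; m/n*n≤m)
  open import Data.Nat.Properties
  open import Algebra.Properties.CommutativeSemigroup *-commutativeSemigroup
    using (x∙yz≈y∙xz; xy∙z≈xz∙y)
  open import Algebra.Properties.CommutativeSemigroup +-commutativeSemigroup
    using (interchange)
  open import Relation.Binary.PropositionalEquality
  open import Relation.Nullary using (yes; no)

  nPk≤n^k : ∀ n k → n P k ≤ n ^ k
  nPk≤n^k n k with k ≤ᵇ n
  ... | false = z≤n
  ... | true  = nP′k≤n^k k
    where
    nP′k≤n^k : ∀ k → n P′ k ≤ n ^ k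
    nP′k≤n^k zero    = ≤-refl
    nP′k≤n^k (suc k) = *-mono-≤ (m∸n≤m n k) (nP′k≤n^k k)

  -- binSum q m s / (q + 1) ^ m is the probability that a binomial variable with
  -- parameters m and 1 / (q + 1) is less than s.
  binTerm : ℕ → ℕ → ℕ → ℕ
  binTerm q m j = (m C j) * q ^ (m ∸ j)

  binSum : ℕ → ℕ → ℕ → ℕ
  binSum q m zero    = 0
  binSum q m (suc s) = binSum q m s + binTerm q m s

  binTerm-vanish : ∀ q {m j} → m < j → binTerm q m j ≡ 0
  binTerm-vanish q {m} {j} m<j = cong (_* q ^ (m ∸ j)) (k>n⇒nCk≡0 m<j)

  binTerm-pascal : ∀ q m j →
    binTerm q (suc m) (suc j) ≡ binTerm q m j + q * binTerm q m (suc j)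
  binTerm-pascal q m j = begin
    (suc m C suc j) * q ^ (m ∸ j)
      ≡⟨ cong (_* q ^ (m ∸ j)) (nCk+nC[k+1]≡[n+1]C[k+1] m j) ⟨
    (m C j + m C suc j) * q ^ (m ∸ j)
      ≡⟨ *-distribʳ-+ (q ^ (m ∸ j)) (m C j) (m C suc j) ⟩
    binTerm q m j + (m C suc j) * q ^ (m ∸ j)
      ≡⟨ cong (binTerm q m j +_) lemma ⟩
    binTerm q m j + q * binTerm q m (suc j) ∎
    where
    open ≡-Reasoning
    lemma : (m C suc j) * q ^ (m ∸ j) ≡ q * binTerm q m (suc j)
    lemma with j <? m
    -- Here truncation makes `m ∸ j` and `suc (m ∸ suc j)` differ, but the coefficient `m C suc j`
    -- is zero.
    ... | no j≮m rewrite k>n⇒nCk≡0 {m} {suc j} (s≤s (≮⇒≥ j≮m)) = sym (*-zeroʳ q)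
    ... | yes j<m = begin
      (m C suc j) * q ^ (m ∸ j)
        ≡⟨ cong (λ i → (m C suc j) * q ^ i) (+-∸-assoc 1 j<m) ⟩
      (m C suc j) * (q * q ^ (m ∸ suc j))
        ≡⟨ x∙yz≈y∙xz (m C suc j) q (q ^ (m ∸ suc j)) ⟩
      q * binTerm q m (suc j) ∎

  -- Split on the outcome of the first trial: a success, of weight 1, lowers the threshold by one,
  -- and a failure, of weight `q`, leaves it. `harris` follows the same recursion, one vertex at a
  -- time.
  binSum-pascal : ∀ q m s →
    binSum q (suc m) (suc s) ≡ binSum q m s + q * binSum q m (suc s)
  binSum-pascal q m zero    = x∙yz≈y∙xz 1 q (q ^ m)
  binSum-pascal q m (suc s) = begin
    binSum q (suc m) (suc s) + binTerm q (suc m) (suc s)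
      ≡⟨ cong₂ _+_ (binSum-pascal q m s) (binTerm-pascal q m s) ⟩
    (a + q * b) + (x + q * y)
      ≡⟨ interchange a (q * b) x (q * y) ⟩
    (a + x) + (q * b + q * y)
      ≡⟨ cong (a + x +_) (*-distribˡ-+ q b y) ⟨
    (a + x) + q * (b + y) ∎
    where
    open ≡-Reasoning
    a = binSum q m s
    b = binSum q m (suc s)
    x = binTerm q m s
    y = binTerm q m (suc s)

  -- The binomial theorem: with `m < s` no nonzero term is cut off.
  binSum-full : ∀ q {m s} → m < s → binSum q m s ≡ suc q ^ m
  binSum-full q {zero} {suc zero}    _ = refl
  binSum-full q {zero} {suc (suc s)} _ = cong₂ _+_
    (binSum-full q {zero} {suc s} z<s) (binTerm-vanish q {zero} {suc s} z<s)
  binSum-full q {suc m} {suc s} (s≤s m<s) = trans (binSum-pascal q m s)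
    (cong₂ _+_ (binSum-full q m<s) (cong (q *_) (binSum-full q (m<n⇒m<1+n m<s))))

  -- After a success in the added trial the others must meet a stricter bound, so an extra trial
  -- never makes few successes more likely.
  binSum-decreasing : ∀ q m s → binSum q (suc m) s ≤ suc q * binSum q m s
  binSum-decreasing q m zero    = z≤n
  binSum-decreasing q m (suc s) = begin
    binSum q (suc m) (suc s)                    ≡⟨ binSum-pascal q m s ⟩
    binSum q m s + q * binSum q m (suc s)
      ≤⟨ +-monoˡ-≤ (q * binSum q m (suc s)) (m≤m+n (binSum q m s) (binTerm q m s)) ⟩
    binSum q m (suc s) + q * binSum q m (suc s) ∎
    where open ≤-Reasoning

  -- Iterates `binSum-decreasing`, with the two probabilities compared by cross-multiplication. It
  -- lets an edge with more than `k` vertices be treated like one with `k`.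
  binSum-antitone : ∀ q s {k m} → k ≤ m →
    binSum q m s * suc q ^ k ≤ binSum q k s * suc q ^ m
  binSum-antitone q s {k} {m} k≤m = subst
    (λ m → binSum q m s * suc q ^ k ≤ binSum q k s * suc q ^ m)
    (m∸n+n≡m k≤m) (shifted (m ∸ k))
    where
    open ≤-Reasoning
    shifted : ∀ i → binSum q (i + k) s * suc q ^ k ≤ binSum q k s * suc q ^ (i + k)
    shifted zero    = ≤-refl
    shifted (suc i) = begin
      binSum q (suc (i + k)) s * suc q ^ k       ≤⟨ *-monoˡ-≤ _ (binSum-decreasing q (i + k) s) ⟩
      suc q * binSum q (i + k) s * suc q ^ k     ≡⟨ *-assoc (suc q) (binSum q (i + k) s) _ ⟩
      suc q * (binSum q (i + k) s * suc q ^ k)   ≤⟨ *-monoʳ-≤ (suc q) (shifted i) ⟩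
      suc q * (binSum q k s * suc q ^ (i + k))   ≡⟨ *-assoc (suc q) (binSum q k s) _ ⟨
      suc q * binSum q k s * suc q ^ (i + k)
        ≡⟨ cong (_* suc q ^ (i + k)) (*-comm (suc q) (binSum q k s)) ⟩
      binSum q k s * suc q * suc q ^ (i + k)     ≡⟨ *-assoc (binSum q k s) (suc q) _ ⟩
      binSum q k s * suc q ^ suc (i + k)         ∎

  -- `(m C j) * j !` is a falling factorial, at most `m ^ j`. For positive `m` this says that each
  -- term in the expansion of (1 + 1/m)^m is at most 1/j!.
  binTerm-!-≤ : ∀ m j → binTerm m m j * j ! ≤ m ^ m
  binTerm-!-≤ m j with j ≤? m
  ... | no j≰m rewrite binTerm-vanish m (≰⇒> j≰m) = z≤n
  ... | yes j≤m = begin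
    (m C j) * m ^ (m ∸ j) * j !   ≡⟨ xy∙z≈xz∙y (m C j) (m ^ (m ∸ j)) (j !) ⟩
    (m C j) * j ! * m ^ (m ∸ j)   ≡⟨ cong (λ c → c * j ! * m ^ (m ∸ j)) (nCk≡nPk/k! j≤m) ⟩
    -- The quotient is a floor; rounding down agrees with the direction of the inequality.
    ((m P j) / j !) {{j !≢0}} * j ! * m ^ (m ∸ j)
      ≤⟨ *-monoˡ-≤ (m ^ (m ∸ j)) (≤-trans (m/n*n≤m (m P j) (j !) {{j !≢0}}) (nPk≤n^k m j)) ⟩
    m ^ j * m ^ (m ∸ j)         ≡⟨ ^-distribˡ-+-* m j (m ∸ j) ⟨
    m ^ (j + (m ∸ j))           ≡⟨ cong (m ^_) (m+[n∸m]≡n j≤m) ⟩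
    m ^ m                       ∎
    where open ≤-Reasoning

-- From the condition on e to an inequality in ℕ.

module ExponentialCondition where

  open BinomialSums
  open import Algebra.Bundles using (module CommutativeRing)
  open import Data.Fin using (toℕ)
  open import Data.Fin.Properties using (toℕ-inject₁; toℕ-fromℕ)
  import Data.Integer as ℤ
  import Data.Integer.Properties as ℤ
  open import Data.Nat as ℕ using (ℕ; zero; suc; s≤s; _∸_; _!)
  open import Data.Nat.Combinatorics using (_C_)
  import Data.Nat.Properties as ℕ
  open import Data.Nat.Tactic.RingSolver using (solve-∀)
  open import Data.Product using (_,_)
  open import Data.Rational hiding (NonZero)
  open import Data.Rational.Properties
  open import Data.Rational.Solver using (module +-*-Solver)
  open +-*-Solver using (solve; _:=_; _:*_; _:+_; _:-_; con)
  import Data.Rational.Unnormalised as ℚᵘ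
  import Data.Rational.Unnormalised.Properties as ℚᵘ
  open import Algebra.Definitions.RawSemiring +-*-rawSemiring using (_^_)
  open CommutativeRing +-*-commutativeRing using (semiring; commutativeSemiring)
  open import Algebra.Properties.CommutativeSemiring.Exp commutativeSemiring
    using (^-distrib-*; ^-homo-*)
  open import Algebra.Properties.Semiring.Sum semiring using (sum-init-last; sum-cong-≗)
  open import Relation.Binary.PropositionalEquality

  toℚᵘ-fromℕ : ∀ m → toℚᵘ (fromℕ m) ℚᵘ.≃ ℚᵘ.mkℚᵘ (ℤ.+ m) 0
  toℚᵘ-fromℕ m = toℚᵘ-fromℚᵘ (ℚᵘ.mkℚᵘ (ℤ.+ m) 0)

  fromℕ-+ : ∀ m n → fromℕ (m ℕ.+ n) ≡ fromℕ m + fromℕ n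
  fromℕ-+ m n = toℚᵘ-injective (begin
    toℚᵘ (fromℕ (m ℕ.+ n))             ≈⟨ toℚᵘ-fromℕ (m ℕ.+ n) ⟩
    ℚᵘ.mkℚᵘ (ℤ.+ (m ℕ.+ n)) 0
      ≡⟨ cong₂ (λ i j → ℚᵘ.mkℚᵘ (i ℤ.+ j) 0) (ℤ.*-identityʳ (ℤ.+ m)) (ℤ.*-identityʳ (ℤ.+ n)) ⟨
    ℚᵘ.mkℚᵘ (ℤ.+ m) 0 ℚᵘ.+ ℚᵘ.mkℚᵘ (ℤ.+ n) 0
      ≈⟨ ℚᵘ.+-cong (toℚᵘ-fromℕ m) (toℚᵘ-fromℕ n) ⟨
    toℚᵘ (fromℕ m) ℚᵘ.+ toℚᵘ (fromℕ n)        ≈⟨ toℚᵘ-homo-+ (fromℕ m) (fromℕ n) ⟨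
    toℚᵘ (fromℕ m + fromℕ n)           ∎)
    where open ℚᵘ.≃-Reasoning

  fromℕ-* : ∀ m n → fromℕ (m ℕ.* n) ≡ fromℕ m * fromℕ n
  fromℕ-* m n = toℚᵘ-injective (begin
    toℚᵘ (fromℕ (m ℕ.* n))             ≈⟨ toℚᵘ-fromℕ (m ℕ.* n) ⟩
    ℚᵘ.mkℚᵘ (ℤ.+ (m ℕ.* n)) 0             ≡⟨ cong (λ i → ℚᵘ.mkℚᵘ i 0) (ℤ.pos-* m n) ⟩
    ℚᵘ.mkℚᵘ (ℤ.+ m) 0 ℚᵘ.* ℚᵘ.mkℚᵘ (ℤ.+ n) 0
      ≈⟨ ℚᵘ.*-cong (toℚᵘ-fromℕ m) (toℚᵘ-fromℕ n) ⟨
    toℚᵘ (fromℕ m) ℚᵘ.* toℚᵘ (fromℕ n)        ≈⟨ toℚᵘ-homo-* (fromℕ m) (fromℕ n) ⟨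
    toℚᵘ (fromℕ m * fromℕ n)           ∎)
    where open ℚᵘ.≃-Reasoning

  fromℕ-^ : ∀ m k → fromℕ (m ℕ.^ k) ≡ fromℕ m ^ k
  fromℕ-^ m zero    = refl
  fromℕ-^ m (suc k) = trans (fromℕ-* m (m ℕ.^ k)) (cong (fromℕ m *_) (fromℕ-^ m k))

  fromℕ-mono-≤ : ∀ {m n} → m ℕ.≤ n → fromℕ m ≤ fromℕ n
  fromℕ-mono-≤ {m} {n} m≤n = toℚᵘ-cancel-≤ (begin
    toℚᵘ (fromℕ m)     ≃⟨ toℚᵘ-fromℕ m ⟩
    ℚᵘ.mkℚᵘ (ℤ.+ m) 0  ≤⟨ ℚᵘ.*≤* (ℤ.*-monoʳ-≤-nonNeg (ℤ.+ 1) (ℤ.+≤+ m≤n)) ⟩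
    ℚᵘ.mkℚᵘ (ℤ.+ n) 0  ≃⟨ toℚᵘ-fromℕ n ⟨
    toℚᵘ (fromℕ n)     ∎)
    where open ℚᵘ.≤-Reasoning

  fromℕ-cancel-≤ : ∀ {m n} → fromℕ m ≤ fromℕ n → m ℕ.≤ n
  fromℕ-cancel-≤ {m} {n} m≤n = ℤ.drop‿+≤+ (ℤ.*-cancelʳ-≤-pos _ _ (ℤ.+ 1) (ℚᵘ.drop-*≤* (begin
    ℚᵘ.mkℚᵘ (ℤ.+ m) 0  ≃⟨ toℚᵘ-fromℕ m ⟨
    toℚᵘ (fromℕ m)     ≤⟨ toℚᵘ-mono-≤ m≤n ⟩
    toℚᵘ (fromℕ n)     ≃⟨ toℚᵘ-fromℕ n ⟩
    ℚᵘ.mkℚᵘ (ℤ.+ n) 0  ∎)))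
    where open ℚᵘ.≤-Reasoning

  fromℕ-nonNeg : ∀ m → NonNegative (fromℕ m)
  fromℕ-nonNeg m = normalize-nonNeg m 1

  1/-inverse : ∀ a .{{_ : ℕ.NonZero a}} → (ℤ.+ 1 / a) * fromℕ a ≡ 1ℚ
  1/-inverse (suc a) = toℚᵘ-injective (begin
    toℚᵘ ((ℤ.+ 1 / suc a) * fromℕ (suc a))
      ≈⟨ toℚᵘ-homo-* (ℤ.+ 1 / suc a) (fromℕ (suc a)) ⟩
    toℚᵘ (ℤ.+ 1 / suc a) ℚᵘ.* toℚᵘ (fromℕ (suc a))
      ≈⟨ ℚᵘ.*-cong (toℚᵘ-fromℚᵘ (ℚᵘ.mkℚᵘ (ℤ.+ 1) a)) (toℚᵘ-fromℕ (suc a)) ⟩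
    ℚᵘ.mkℚᵘ (ℤ.+ 1) a ℚᵘ.* ℚᵘ.mkℚᵘ (ℤ.+ suc a) 0
      ≈⟨ ℚᵘ.*≡* (cong (ℤ.+_) (lemma a)) ⟩
    ℚᵘ.1ℚᵘ ∎)
    where
    open ℚᵘ.≃-Reasoning
    lemma : ∀ a → (1 ℕ.* suc a) ℕ.* 1 ≡ 1 ℕ.* (suc a ℕ.* 1)
    lemma = solve-∀

  -- `binTerm-!-≤` bounds each term by the matching 1/i!, multiplied by `D ^ D`; summing produces
  -- the partial sum of e.
  binSum-expSum : ∀ D n → fromℕ (binSum D D (suc n)) ≤ expSum n * fromℕ (D ℕ.^ D)
  binSum-expSum D n = go n
    where
    open ≤-Reasoning
    term : ∀ i → fromℕ (binTerm D D i) ≤ 1/! i * fromℕ (D ℕ.^ D)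
    term i = begin
      x                          ≡⟨ *-identityˡ x ⟨
      1ℚ * x                     ≡⟨ cong (_* x) (1/-inverse (i !) {{i ℕ.!≢0}}) ⟨
      1/! i * fromℕ (i !) * x    ≡⟨ *-assoc (1/! i) (fromℕ (i !)) x ⟩
      1/! i * (fromℕ (i !) * x)  ≡⟨ cong (1/! i *_) (*-comm (fromℕ (i !)) x) ⟩
      1/! i * (x * fromℕ (i !))  ≡⟨ cong (1/! i *_) (fromℕ-* (binTerm D D i) (i !)) ⟨
      1/! i * fromℕ (binTerm D D i ℕ.* i !)
        ≤⟨ *-monoˡ-≤-nonNeg (1/! i) {{normalize-nonNeg 1 (i !) {{i ℕ.!≢0}}}}
             (fromℕ-mono-≤ (binTerm-!-≤ D i)) ⟩
      1/! i * fromℕ (D ℕ.^ D)    ∎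
      where x = fromℕ (binTerm D D i)
    go : ∀ n → fromℕ (binSum D D (suc n)) ≤ expSum n * fromℕ (D ℕ.^ D)
    go zero    = term 0
    go (suc n) = begin
      fromℕ (binSum D D (suc n) ℕ.+ binTerm D D (suc n))
        ≡⟨ fromℕ-+ (binSum D D (suc n)) (binTerm D D (suc n)) ⟩
      fromℕ (binSum D D (suc n)) + fromℕ (binTerm D D (suc n))
        ≤⟨ +-mono-≤ (go n) (term (suc n)) ⟩
      expSum n * fromℕ (D ℕ.^ D) + 1/! (suc n) * fromℕ (D ℕ.^ D)
        ≡⟨ *-distribʳ-+ (fromℕ (D ℕ.^ D)) (expSum n) (1/! (suc n)) ⟨
      expSum (suc n) * fromℕ (D ℕ.^ D) ∎

  -- `sum` over `Fin` unfolds at its first index, whereas `binSum` grows at its last; this brings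
  -- the two recursions into line.
  binomialTail-suc : ∀ k s t .{{_ : ℕ.NonZero t}} → binomialTail k (suc s) t ≡
    binomialTail k s t + fromℕ (k C s) * (ℤ.+ 1 / t) ^ s * (1ℚ - ℤ.+ 1 / t) ^ (k ∸ s)
  binomialTail-suc k s t = trans (sum-init-last {s} (λ j → g (toℕ j)))
    (cong₂ _+_ (sum-cong-≗ {s} λ j → cong g (toℕ-inject₁ j)) (cong g (toℕ-fromℕ s)))
    where
    g : ℕ → ℚ
    g j = fromℕ (k C j) * (ℤ.+ 1 / t) ^ j * (1ℚ - ℤ.+ 1 / t) ^ (k ∸ j)

  -- Of the `k` factors `suc q`, the term at `j` uses `j` to cancel the powers of 1/t and `k ∸ j` to
  -- turn 1 - 1/t into `q`. The bound `s ≤ k` makes these exponents add up to `k`.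
  binomialTail-scaled : ∀ k s q → s ℕ.≤ k →
    binomialTail k s (suc q) * fromℕ (suc q ℕ.^ k) ≡ fromℕ (binSum q k s)
  binomialTail-scaled k zero    q _   = *-zeroˡ (fromℕ (suc q ℕ.^ k))
  binomialTail-scaled k (suc s) q s<k = begin
    binomialTail k (suc s) (suc q) * T
      ≡⟨ cong (_* T) (binomialTail-suc k s (suc q)) ⟩
    (binomialTail k s (suc q) + c * p ^ s * r ^ (k ∸ s)) * T
      ≡⟨ *-distribʳ-+ T (binomialTail k s (suc q)) (c * p ^ s * r ^ (k ∸ s)) ⟩
    binomialTail k s (suc q) * T + c * p ^ s * r ^ (k ∸ s) * T
      ≡⟨ cong₂ _+_ (binomialTail-scaled k s q (ℕ.<⇒≤ s<k)) term ⟩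
    fromℕ (binSum q k s) + fromℕ (binTerm q k s)
      ≡⟨ fromℕ-+ (binSum q k s) (binTerm q k s) ⟨
    fromℕ (binSum q k (suc s)) ∎
    where
    open ≡-Reasoning
    T = fromℕ (suc q ℕ.^ k)
    t = fromℕ (suc q)
    c = fromℕ (k C s)
    p = ℤ.+ 1 / suc q
    r = 1ℚ - p
    rt≡q : r * t ≡ fromℕ q
    rt≡q = begin
      (1ℚ - p) * t            ≡⟨ solve 2 (λ p t → (con 1ℚ :- p) :* t := t :- p :* t) refl p t ⟩
      t - p * t               ≡⟨ cong₂ _-_ (fromℕ-+ 1 q) (1/-inverse (suc q)) ⟩
      1ℚ + fromℕ q - 1ℚ       ≡⟨ solve 1 (λ x → con 1ℚ :+ x :- con 1ℚ := x) refl (fromℕ q) ⟩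
      fromℕ q                 ∎
    T-split : T ≡ t ^ s * t ^ (k ∸ s)
    T-split = begin
      fromℕ (suc q ℕ.^ k)     ≡⟨ fromℕ-^ (suc q) k ⟩
      t ^ k                   ≡⟨ cong (t ^_) (ℕ.m+[n∸m]≡n (ℕ.<⇒≤ s<k)) ⟨
      t ^ (s ℕ.+ (k ∸ s))     ≡⟨ ^-homo-* t s (k ∸ s) ⟩
      t ^ s * t ^ (k ∸ s)     ∎
    1^ : ∀ n → 1ℚ ^ n ≡ 1ℚ
    1^ zero    = refl
    1^ (suc n) = trans (*-identityˡ (1ℚ ^ n)) (1^ n)
    term : c * p ^ s * r ^ (k ∸ s) * T ≡ fromℕ (binTerm q k s)
    term = begin
      c * p ^ s * r ^ (k ∸ s) * T
        ≡⟨ cong (c * p ^ s * r ^ (k ∸ s) *_) T-split ⟩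
      c * p ^ s * r ^ (k ∸ s) * (t ^ s * t ^ (k ∸ s))
        ≡⟨ solve 5 (λ c x y u v → c :* x :* y :* (u :* v) := c :* (x :* u) :* (y :* v)) refl
             c (p ^ s) (r ^ (k ∸ s)) (t ^ s) (t ^ (k ∸ s)) ⟩
      c * (p ^ s * t ^ s) * (r ^ (k ∸ s) * t ^ (k ∸ s))
        ≡⟨ cong₂ (λ x y → c * x * y) (^-distrib-* p t s) (^-distrib-* r t (k ∸ s)) ⟨
      c * (p * t) ^ s * (r * t) ^ (k ∸ s)
        ≡⟨ cong₂ (λ x y → c * x ^ s * y ^ (k ∸ s)) (1/-inverse (suc q)) rt≡q ⟩
      c * 1ℚ ^ s * fromℕ q ^ (k ∸ s)
        ≡⟨ cong₂ (λ x y → c * x * y) (1^ s) (sym (fromℕ-^ q (k ∸ s))) ⟩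
      c * 1ℚ * fromℕ (q ℕ.^ (k ∸ s))
        ≡⟨ cong (_* fromℕ (q ℕ.^ (k ∸ s))) (*-identityʳ c) ⟩
      c * fromℕ (q ℕ.^ (k ∸ s))
        ≡⟨ fromℕ-* (k C s) (q ℕ.^ (k ∸ s)) ⟨
      fromℕ (binTerm q k s) ∎

  -- Integrality absorbs the error term, which is K/(K + 1) and so less than 1.
  nearly-≤ : ∀ {x K} → fromℕ x ≤ (1ℚ + ℤ.+ 1 / suc K) * fromℕ K → x ℕ.≤ K
  nearly-≤ {x} {K} h = ℕ.s≤s⁻¹ (ℕ.*-cancelʳ-< (suc K) x (suc K)
    (ℕ.≤-trans (s≤s scaled) (ℕ.≤-reflexive (square K))))
    where
    open ≤-Reasoning
    ε = ℤ.+ 1 / suc K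
    -- (K + 2) K falls one short of (K + 1)^2, which yields the strict inequality x < K + 1.
    square : ∀ K → suc (suc (suc K) ℕ.* K) ≡ suc K ℕ.* suc K
    square = solve-∀
    scaled : x ℕ.* suc K ℕ.≤ suc (suc K) ℕ.* K
    scaled = fromℕ-cancel-≤ (begin
      fromℕ (x ℕ.* suc K)
        ≡⟨ fromℕ-* x (suc K) ⟩
      fromℕ x * fromℕ (suc K)
        ≤⟨ *-monoʳ-≤-nonNeg (fromℕ (suc K)) {{fromℕ-nonNeg (suc K)}} h ⟩
      (1ℚ + ε) * fromℕ K * fromℕ (suc K)
        ≡⟨ solve 3 (λ e k l → (con 1ℚ :+ e) :* k :* l := (e :* l :+ l) :* k) refl
             ε (fromℕ K) (fromℕ (suc K)) ⟩
      (ε * fromℕ (suc K) + fromℕ (suc K)) * fromℕ K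
        ≡⟨ cong (λ y → (y + fromℕ (suc K)) * fromℕ K) (1/-inverse (suc K)) ⟩
      (1ℚ + fromℕ (suc K)) * fromℕ K
        ≡⟨ cong (_* fromℕ K) (fromℕ-+ 1 (suc K)) ⟨
      fromℕ (suc (suc K)) * fromℕ K
        ≡⟨ fromℕ-* (suc (suc K)) K ⟨
      fromℕ (suc (suc K) ℕ.* K) ∎)

  -- With p = `binSum q k s` / `suc q ^ k` the conclusion is p ≤ D^D / (D + 1)^(D + 1), the local
  -- lemma condition for weights 1/(D + 1). It follows from e p (D + 1) ≤ 1 because e is at least (1
  -- + 1/D)^D.
  condition⇒small : ∀ q k s D → s ℕ.≤ k →
    e *ℝ fromℚ (binomialTail k s (suc q)) *ℝ fromℚ (fromℕ (suc D)) ≤ℝ fromℚ 1ℚ →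
    binSum q k s ℕ.* suc D ℕ.^ suc D ℕ.≤ suc q ℕ.^ k ℕ.* D ℕ.^ D
  condition⇒small q k s D s≤k cond =
    let N , below = cond ε (positive⁻¹ ε {{normalize-pos 1 (suc K)}})
    -- The index is at least `N`, so that the hypothesis holds up to `ε`, and at least `D`, so that
    -- the partial sum of e covers all terms of (1 + 1/D)^D.
    in nearly-≤ (bound (N ℕ.⊔ D) (ℕ.m≤n⊔m N D) (below (N ℕ.⊔ D) (ℕ.m≤m⊔n N D)))
    where
    open ≤-Reasoning
    K = suc q ℕ.^ k ℕ.* D ℕ.^ D
    B = binSum q k s
    b = binomialTail k s (suc q)
    S = fromℕ (suc D)
    T = fromℕ (suc q ℕ.^ k)
    E = fromℕ (D ℕ.^ D)
    ε = ℤ.+ 1 / suc K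
    bound : ∀ n → D ℕ.≤ n → expSum n * b * S ≤ 1ℚ + ε →
      fromℕ (B ℕ.* (suc D ℕ.* suc D ℕ.^ D)) ≤ (1ℚ + ε) * fromℕ K
    bound n D≤n below = begin
      fromℕ (B ℕ.* (suc D ℕ.* suc D ℕ.^ D))
        ≡⟨ trans (fromℕ-* B (suc D ℕ.* suc D ℕ.^ D))
             (cong (fromℕ B *_) (fromℕ-* (suc D) (suc D ℕ.^ D))) ⟩
      fromℕ B * (S * fromℕ (suc D ℕ.^ D))
        ≡⟨ cong (λ z → fromℕ B * (S * fromℕ z)) (binSum-full D (s≤s D≤n)) ⟨
      fromℕ B * (S * fromℕ (binSum D D (suc n)))
        ≤⟨ *-monoˡ-≤-nonNeg (fromℕ B) {{fromℕ-nonNeg B}}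
             (*-monoˡ-≤-nonNeg S {{fromℕ-nonNeg (suc D)}} (binSum-expSum D n)) ⟩
      fromℕ B * (S * (expSum n * E))
        ≡⟨ cong (λ z → z * (S * (expSum n * E))) (binomialTail-scaled k s q s≤k) ⟨
      b * T * (S * (expSum n * E))
        ≡⟨ solve 5 (λ b t s e d → b :* t :* (s :* (e :* d)) := e :* b :* s :* (t :* d)) refl
             b T S (expSum n) E ⟩
      expSum n * b * S * (T * E)
        ≡⟨ cong (expSum n * b * S *_) (fromℕ-* (suc q ℕ.^ k) (D ℕ.^ D)) ⟨
      expSum n * b * S * fromℕ K
        ≤⟨ *-monoʳ-≤-nonNeg (fromℕ K) {{fromℕ-nonNeg K}} below ⟩
      (1ℚ + ε) * fromℕ K ∎

open BinomialSums using (binSum; binTerm; binSum-pascal; binSum-full; binSum-antitone)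
open ExponentialCondition using (condition⇒small)
open import Data.Bool using (true; false; if_then_else_)
open import Data.Bool.Properties using () renaming (_≟_ to _≟ᵇ_)
open import Data.Fin using (Fin; zero; suc)
import Data.Fin.Properties as Fin
open import Data.Fin.Subset using (Subset; inside; outside; ∣_∣; _∩_) renaming (_∈_ to _∈ₛ_)
open import Data.Fin.Subset.Properties using (nonempty?; x∈p∩q⁺; x∈p∩q⁻; p⊆q⇒∣p∣≤∣q∣)
open import Data.List using (List; []; _∷_; _++_; map; filter; length; allFin; cartesianProduct)
open import Data.List.Properties
  using (filter-++; length-++; filter-notAll; length-tabulate; partition-defn)
open import Data.List.Membership.Propositional using (_∈_; lose)
open import Data.List.Membership.Propositional.Properties
  using (∈-allFin; ∈-cartesianProduct⁺; ∈-cartesianProduct⁻)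
open import Data.List.Relation.Binary.Permutation.Propositional using (_↭_; ↭-sym; ↭ₛ⇒↭)
open import Data.List.Relation.Binary.Permutation.Propositional.Properties
  using (All-resp-↭; ↭-length; filter-↭; map⁺)
import Data.List.Relation.Binary.Permutation.Setoid.Properties as Setoid↭
open import Data.List.Relation.Unary.All as All using (All; []; _∷_)
open import Data.List.Relation.Unary.All.Properties using (all-filter)
open import Data.List.Relation.Unary.AllPairs using (_∷_)
open import Data.List.Relation.Unary.Any using (here; there)
open import Data.List.Relation.Unary.Unique.Propositional using (Unique)
open import Data.Nat
  using (ℕ; zero; suc; NonZero; >-nonZero; _≤_; _<_; z≤n; s≤s; z<s; s≤s⁻¹; _+_; _*_; _∸_; _^_)
open import Data.Nat.ListAction using (product)
open import Data.Nat.ListAction.Properties using (product-↭)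
open import Data.Nat.Properties
open import Data.Product using (∃-syntax; _×_; _,_; proj₁; proj₂)
open import Data.Rational using (1ℚ)
open import Data.Sum as Sum using (_⊎_; inj₁; inj₂)
open import Data.Vec using ([]; _∷_; here; there)
import Data.Vec.Functional as Func
open import Data.Vec.Properties using (lookup⇒[]=; []=⇒lookup; lookup∘tabulate; ≡-dec)
open import Algebra.Properties.CommutativeSemigroup *-commutativeSemigroup
  using (interchange; x∙yz≈y∙xz; xy∙z≈xz∙y; xy∙z≈y∙xz)
import Algebra.Properties.CommutativeSemigroup +-commutativeSemigroup as +
open import Algebra.Properties.Semiring.Sum +-*-semiring
  using (sum; sum-replicate-zero; sum-cong-≗; ∑-distrib-+; *-distribˡ-sum; *-distribʳ-sum)
open import Function using (_∘_)
open import Relation.Binary using (Decidable; DecidableEquality)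
open import Relation.Binary.PropositionalEquality
open import Relation.Nullary using (¬_; Dec; yes; no; ¬?; _×-dec_; does; contradiction)
open import Relation.Nullary.Decidable using (dec-true)
open import Relation.Unary using (Pred) renaming (Decidable to Decidable₁)

private
  variable
    n t : ℕ

-- The lopsided local lemma for weighted counts.

powers-weaken : ∀ D l {y z} → l ≤ D →
  D ^ l * y ≤ suc D ^ l * z → D ^ D * y ≤ suc D ^ D * z
powers-weaken D l {y} {z} l≤D h = begin
  D ^ D * y                            ≡⟨ split D ⟩
  -- The `D ∸ l` missing factors are supplied as `D` on the left and as the larger `suc D` on the
  -- right, so a conflict count up to `D` may be treated as exactly `D`.
  D ^ (D ∸ l) * (D ^ l * y)            ≤⟨ *-mono-≤ (^-monoˡ-≤ (D ∸ l) (n≤1+n D)) h ⟩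
  suc D ^ (D ∸ l) * (suc D ^ l * z)    ≡⟨ split (suc D) ⟨
  suc D ^ D * z                        ∎
  where
  open ≤-Reasoning
  split : ∀ b {x} → b ^ D * x ≡ b ^ (D ∸ l) * (b ^ l * x)
  split b {x} = begin-equality
    b ^ D * x                  ≡⟨ cong (λ i → b ^ i * x) (m∸n+n≡m l≤D) ⟨
    b ^ (D ∸ l + l) * x        ≡⟨ cong (_* x) (^-distribˡ-+-* b (D ∸ l) l) ⟩
    b ^ (D ∸ l) * b ^ l * x    ≡⟨ *-assoc (b ^ (D ∸ l)) (b ^ l) x ⟩
    b ^ (D ∸ l) * (b ^ l * x)  ∎

remaining : ∀ D {b g n} → b + g ≡ n → suc D * b ≤ n → D * n ≤ suc D * g
remaining D {b} {g} {n} b+g≡n b-small = +-cancelˡ-≤ n (D * n) (suc D * g) (begin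
  n + D * n               ≡⟨ cong (suc D *_) b+g≡n ⟨
  suc D * (b + g)         ≡⟨ *-distribˡ-+ (suc D) b g ⟩
  suc D * b + suc D * g   ≤⟨ +-monoˡ-≤ (suc D * g) b-small ⟩
  n + suc D * g           ∎)
  where open ≤-Reasoning

-- `μ` is an unnormalized expectation and `bad`, `good` are complementary indicators, so that
-- conditional probabilities become cross-multiplied inequalities in ℕ. `Valid` singles out the
-- indices for which the bounds on probabilities and conflicts are available.
module LocalLemma
  {Ω I : Set}
  (μ : (Ω → ℕ) → ℕ)
  (μ-+ : ∀ F G → μ (λ ω → F ω + G ω) ≡ μ F + μ G)
  (μ-mono : ∀ {F G} → (∀ ω → F ω ≤ G ω) → μ F ≤ μ G)
  (bad good : I → Ω → ℕ)
  (bad+good : ∀ i ω → bad i ω + good i ω ≡ 1)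
  {_∼_ : I → I → Set} (_∼?_ : Decidable _∼_)
  (Valid : I → Set)
  where

  avoid : List I → Ω → ℕ
  avoid L ω = product (map (λ i → good i ω) L)

  Sparse : ℕ → List I → Set
  Sparse D L = All Valid L × (∀ i → Valid i → length (filter (i ∼?_) L) ≤ D)

  -- A bound P/Q on the conditional probability of a bad event, cross-multiplied. Being one-sided,
  -- it replaces independence from the non-conflicting events.
  Lopsided : ℕ → ℕ → Set
  Lopsided P Q = ∀ i L → Valid i → All (λ j → ¬ i ∼ j) L →
    μ (λ ω → bad i ω * avoid L ω) * Q ≤ P * μ (avoid L)

  μ-cong : ∀ {F G} → (∀ ω → F ω ≡ G ω) → μ F ≡ μ G
  μ-cong F≗G = ≤-antisym
    (μ-mono λ ω → ≤-reflexive (F≗G ω)) (μ-mono λ ω → ≤-reflexive (sym (F≗G ω)))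

  good≤1 : ∀ i ω → good i ω ≤ 1
  good≤1 i ω = ≤-trans (m≤n+m (good i ω) (bad i ω)) (≤-reflexive (bad+good i ω))

  avoid-++-≤ : ∀ L M ω → avoid (L ++ M) ω ≤ avoid M ω
  avoid-++-≤ []      M ω = ≤-refl
  avoid-++-≤ (i ∷ L) M ω =
    ≤-trans (*-mono-≤ (good≤1 i ω) (avoid-++-≤ L M ω)) (≤-reflexive (*-identityˡ _))

  avoid-↭ : ∀ {L M} → L ↭ M → ∀ ω → avoid L ω ≡ avoid M ω
  avoid-↭ L↭M ω = product-↭ (map⁺ (λ i → good i ω) L↭M)

  μ-split : ∀ i L → μ (λ ω → bad i ω * avoid L ω) + μ (avoid (i ∷ L)) ≡ μ (avoid L)
  μ-split i L = trans (sym (μ-+ _ _)) (μ-cong λ ω →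
    trans (sym (*-distribʳ-+ (avoid L ω) (bad i ω) (good i ω)))
      (trans (cong (_* avoid L ω) (bad+good i ω)) (*-identityˡ _)))

  sparse-tail : ∀ {D i L} → Sparse D (i ∷ L) → Sparse D L
  sparse-tail {i = i} {L} (_ ∷ vL , few) = vL , λ j vj → ≤-trans (drop j) (few j vj)
    where
    drop : ∀ j → length (filter (j ∼?_) L) ≤ length (filter (j ∼?_) (i ∷ L))
    drop j = ≤-trans (m≤n+m _ (length (filter (j ∼?_) (i ∷ []))))
      (≤-reflexive (trans (sym (length-++ (filter (j ∼?_) (i ∷ []))))
        (cong length (sym (filter-++ (j ∼?_) (i ∷ []) L)))))

  sparse-↭ : ∀ {D L M} → L ↭ M → Sparse D L → Sparse D M
  sparse-↭ L↭M (vL , few) = All-resp-↭ L↭M vL , λ i vi →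
    ≤-trans (≤-reflexive (↭-length (filter-↭ (i ∼?_) (↭-sym L↭M)))) (few i vi)

  module _ {P Q D : ℕ} .{{_ : NonZero Q}} (lopsided : Lopsided P Q)
           (small : P * suc D ^ suc D ≤ Q * D ^ D) where
    open ≤-Reasoning

    -- `x` is at most P/Q of `z`, `small` bounds P/Q by D^D / (D + 1)^(D + 1), and the second
    -- premise trades `D ^ D * z` for `suc D ^ D * w`; one factor `suc D` remains.
    conclude : ∀ {x w z} → x * Q ≤ P * z → D ^ D * z ≤ suc D ^ D * w → suc D * x ≤ w
    conclude {x} {w} {z} xQ≤Pz Dz≤Sw = *-cancelʳ-≤ _ _ (Q * suc D ^ D) (begin
      suc D * x * (Q * suc D ^ D)    ≡⟨ cong (_* (Q * suc D ^ D)) (*-comm (suc D) x) ⟩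
      x * suc D * (Q * suc D ^ D)    ≡⟨ interchange x (suc D) Q (suc D ^ D) ⟩
      x * Q * suc D ^ suc D          ≤⟨ *-monoˡ-≤ (suc D ^ suc D) xQ≤Pz ⟩
      P * z * suc D ^ suc D          ≡⟨ xy∙z≈xz∙y P z (suc D ^ suc D) ⟩
      P * suc D ^ suc D * z          ≤⟨ *-monoˡ-≤ z small ⟩
      Q * D ^ D * z                  ≡⟨ *-assoc Q (D ^ D) z ⟩
      Q * (D ^ D * z)                ≤⟨ *-monoʳ-≤ Q Dz≤Sw ⟩
      Q * (suc D ^ D * w)            ≡⟨ *-assoc Q (suc D ^ D) w ⟨
      Q * suc D ^ D * w              ≡⟨ *-comm (Q * suc D ^ D) w ⟩
      w * (Q * suc D ^ D)            ∎)
      where instance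
        _ = m^n≢0 (suc D) D
        _ = m*n≢0 Q (suc D ^ D)

    -- The length bound ℓ makes the mutual recursion structural.
    bad-small : ∀ ℓ i L → length L ≤ ℓ → Valid i → Sparse D L →
      suc D * μ (λ ω → bad i ω * avoid L ω) ≤ μ (avoid L)

    -- Chain rule: the events of `L` are added one at a time, and by `bad-small` each keeps at least
    -- D/(D + 1) of the weight.
    avoid-++-large : ∀ ℓ L M → length (L ++ M) ≤ ℓ → Sparse D (L ++ M) →
      D ^ length L * μ (avoid M) ≤ suc D ^ length L * μ (avoid (L ++ M))

    bad-small ℓ i L |L|≤ℓ vi sparse = conclude
      (begin
        μ (λ ω → bad i ω * avoid L ω) * Q
          -- Dropping the conflicting events only enlarges this weight, and the lopsided bound
          -- applies to the rest.
          ≤⟨ *-monoˡ-≤ Q (μ-mono λ ω → *-monoʳ-≤ (bad i ω)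
               (≤-trans (≤-reflexive (avoid-↭ L↭ ω)) (avoid-++-≤ near far ω))) ⟩
        μ (λ ω → bad i ω * avoid far ω) * Q
          ≤⟨ lopsided i far vi (all-filter (λ j → ¬? (i ∼? j)) L) ⟩
        P * μ (avoid far) ∎)
      -- Restoring the conflicting events costs at most a factor (D + 1)/D each, and sparsity allows
      -- at most `D` of them.
      (powers-weaken D (length near) (proj₂ sparse i vi) (begin
        D ^ length near * μ (avoid far)
          ≤⟨ avoid-++-large ℓ near far
               (≤-trans (≤-reflexive (↭-length (↭-sym L↭))) |L|≤ℓ) (sparse-↭ L↭ sparse) ⟩
        suc D ^ length near * μ (avoid (near ++ far))
          ≡⟨ cong (suc D ^ length near *_) (μ-cong (avoid-↭ L↭)) ⟨
        suc D ^ length near * μ (avoid L) ∎))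
      where
      near = filter (i ∼?_) L
      far  = filter (λ j → ¬? (i ∼? j)) L
      L↭ : L ↭ near ++ far
      L↭ = subst (λ (ys , zs) → L ↭ ys ++ zs) (partition-defn (i ∼?_) L)
             (↭ₛ⇒↭ (Setoid↭.partition-↭ (setoid I) (i ∼?_) L))

    avoid-++-large ℓ       []      M _           _      = ≤-refl
    avoid-++-large (suc ℓ) (i ∷ L) M (s≤s |LM|≤ℓ) sparse = begin
      D * D ^ l * y               ≡⟨ xy∙z≈y∙xz D (D ^ l) y ⟩
      D ^ l * (D * y)             ≡⟨ x∙yz≈y∙xz (D ^ l) D y ⟩
      D * (D ^ l * y)             ≤⟨ *-monoʳ-≤ D
                                       (avoid-++-large ℓ L M |LM|≤ℓ (sparse-tail sparse)) ⟩
      D * (suc D ^ l * z)         ≡⟨ x∙yz≈y∙xz D (suc D ^ l) z ⟩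
      suc D ^ l * (D * z)         ≤⟨ *-monoʳ-≤ (suc D ^ l) (remaining D (μ-split i (L ++ M))
                                       (bad-small ℓ i (L ++ M) |LM|≤ℓ
                                         (All.head (proj₁ sparse)) (sparse-tail sparse))) ⟩
      suc D ^ l * (suc D * w)     ≡⟨ xy∙z≈y∙xz (suc D) (suc D ^ l) w ⟨
      suc D * suc D ^ l * w       ∎
      where
      l = length L
      y = μ (avoid M)
      z = μ (avoid (L ++ M))
      w = μ (avoid (i ∷ L ++ M))

    -- Every event leaves at least the fraction D/(D + 1) of the weight, which is positive because
    -- `D` is nonzero.
    avoid-positive : .{{_ : NonZero D}} → 0 < μ (λ _ → 1) → ∀ L → Sparse D L → 0 < μ (avoid L)
    avoid-positive 0<μ []      _      = 0<μ
    avoid-positive 0<μ (i ∷ L) sparse = *-cancelˡ-< (suc D) 0 _ (begin-strict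
      suc D * 0                  ≡⟨ *-zeroʳ (suc D) ⟩
      0                          ≡⟨ *-zeroʳ D ⟨
      D * 0                      <⟨ *-monoʳ-< D (avoid-positive 0<μ L (sparse-tail sparse)) ⟩
      D * μ (avoid L)            ≤⟨ remaining D (μ-split i L)
                                      (bad-small (length L) i L ≤-refl
                                        (All.head (proj₁ sparse)) (sparse-tail sparse)) ⟩
      suc D * μ (avoid (i ∷ L))  ∎)

-- Weighted counts of colorings and threshold indicators.

sum-mono : ∀ {v w : Fin n → ℕ} → (∀ i → v i ≤ w i) → sum v ≤ sum w
sum-mono {zero}  v≤w = z≤n
sum-mono {suc n} v≤w = +-mono-≤ (v≤w zero) (sum-mono (v≤w ∘ suc))

sum-bounded : ∀ {v : Fin n → ℕ} {b} → (∀ i → v i ≤ b) → sum v ≤ n * b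
sum-bounded {zero}  v≤b = z≤n
sum-bounded {suc n} v≤b = +-mono-≤ (v≤b zero) (sum-bounded (v≤b ∘ suc))

sum-positive : ∀ (v : Fin n → ℕ) → 0 < sum v → ∃[ i ] 0 < v i
sum-positive {suc n} v 0<Σ with v zero in eq
... | suc _ = zero , subst (0 <_) (sym eq) z<s
... | zero with sum-positive (v ∘ suc) 0<Σ
...   | i , 0<v = suc i , 0<v

-- The removed entry is added back on the left to avoid subtraction; `chebyshev` uses this to single
-- out the weight at `c`.
sum-replace : ∀ (v w : Fin n → ℕ) i →
  sum (λ j → if does (j Fin.≟ i) then v j else w j) + w i ≡ sum w + v i
sum-replace v w zero    = +.xy∙z≈zy∙x (v zero) (sum (w ∘ suc)) (w zero)
sum-replace v w (suc i) = begin
  w zero + s + w (suc i)               ≡⟨ +-assoc (w zero) s (w (suc i)) ⟩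
  w zero + (s + w (suc i))             ≡⟨ cong (w zero +_) (sum-replace (v ∘ suc) (w ∘ suc) i) ⟩
  w zero + (sum (w ∘ suc) + v (suc i)) ≡⟨ +-assoc (w zero) (sum (w ∘ suc)) (v (suc i)) ⟨
  w zero + sum (w ∘ suc) + v (suc i)   ∎
  where
  open ≡-Reasoning
  s = sum (λ j → if does (j Fin.≟ i) then v (suc j) else w (suc j))

-- The expectation over a uniformly random coloring, scaled by `t ^ n`. Recursion on the first
-- vertex allows `harris` to condition on its color.
total : ∀ n → (Coloring n t → ℕ) → ℕ
total zero    F = F Func.[]
total (suc n) F = sum λ a → total n (λ χ → F (a Func.∷ χ))

total-mono : ∀ n {F G : Coloring n t → ℕ} → (∀ χ → F χ ≤ G χ) → total n F ≤ total n G
total-mono zero    F≤G = F≤G Func.[]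
total-mono (suc n) F≤G = sum-mono λ a → total-mono n λ χ → F≤G (a Func.∷ χ)

total-+ : ∀ n (F G : Coloring n t → ℕ) → total n (λ χ → F χ + G χ) ≡ total n F + total n G
total-+ zero    F G = refl
total-+ (suc n) F G = trans
  (sum-cong-≗ λ a → total-+ n (λ χ → F (a Func.∷ χ)) (λ χ → G (a Func.∷ χ)))
  (∑-distrib-+ (λ a → total n (λ χ → F (a Func.∷ χ)))
    (λ a → total n (λ χ → G (a Func.∷ χ))))

total-positive : ∀ n (F : Coloring n t → ℕ) → 0 < total n F → ∃[ χ ] 0 < F χ
total-positive zero    F 0<Σ = Func.[] , 0<Σ
total-positive (suc n) F 0<Σ with sum-positive _ 0<Σ
... | a , 0<Σₐ with total-positive n (λ χ → F (a Func.∷ χ)) 0<Σₐ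
...   | χ , 0<F = a Func.∷ χ , 0<F

total-1 : ∀ n → 0 < total {suc t} n (λ _ → 1)
total-1 zero    = z<s
total-1 (suc n) = ≤-trans (total-1 n) (m≤m+n _ _)

-- `fewer` and `atLeast` are complementary indicators that recurse on threshold and count together:
-- in `harris` a vertex of color `c` lowers the threshold by computation alone.
fewer : ℕ → ℕ → ℕ
fewer zero    _       = 0
fewer (suc s) zero    = 1
fewer (suc s) (suc x) = fewer s x

atLeast : ℕ → ℕ → ℕ
atLeast zero    _       = 1
atLeast (suc s) zero    = 0
atLeast (suc s) (suc x) = atLeast s x

fewer+atLeast : ∀ s x → fewer s x + atLeast s x ≡ 1
fewer+atLeast zero    x       = refl
fewer+atLeast (suc s) zero    = refl
fewer+atLeast (suc s) (suc x) = fewer+atLeast s x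

atLeast-mono : ∀ s {x y} → x ≤ y → atLeast s x ≤ atLeast s y
atLeast-mono zero    _         = ≤-refl
atLeast-mono (suc s) z≤n       = z≤n
atLeast-mono (suc s) (s≤s x≤y) = atLeast-mono s x≤y

atLeast-positive : ∀ s x → 0 < atLeast s x → s ≤ x
atLeast-positive zero    x       _   = z≤n
atLeast-positive (suc s) (suc x) 0<a = s≤s (atLeast-positive s x 0<a)

-- Harris' inequality on the vertices of one edge.

Recolors : Subset n → Fin t → Coloring n t → Coloring n t → Set
Recolors f c χ χ′ = ∀ v → χ v ≡ χ′ v ⊎ (v ∈ₛ f × χ′ v ≡ c)

-- The increasing functions of Harris' inequality, for the order in which `c` lies above every other
-- color on `f` and colors off `f` are fixed.
Favors : Subset n → Fin t → (Coloring n t → ℕ) → Set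
Favors f c G = ∀ {χ χ′} → Recolors f c χ χ′ → G χ ≤ G χ′

favors-∷ : ∀ {s} {f : Subset n} {c : Fin t} {G} a →
  Favors (s ∷ f) c G → Favors f c (λ χ → G (a Func.∷ χ))
favors-∷ a fav r = fav λ where
  zero    → inj₁ refl
  (suc v) → Sum.map₂ (λ (v∈f , eq) → there v∈f , eq) (r v)

-- Chebyshev's sum inequality: the weights u at c and u + r elsewhere have the sum
-- t * (u + r) ∸ r, whose subtracted part is moved to the left-hand side.
chebyshev : ∀ (v : Fin t → ℕ) c u r → (∀ a → v a ≤ v c) →
  t * sum (λ a → if does (a Fin.≟ c) then u * v a else (u + r) * v a) + r * sum v ≤
  t * (u + r) * sum v
chebyshev {t} v c u r v≤vc = begin
  t * X + r * V                ≤⟨ +-monoʳ-≤ (t * X) (*-monoʳ-≤ r (sum-bounded v≤vc)) ⟩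
  t * X + r * (t * v c)        ≡⟨ cong (t * X +_) (x∙yz≈y∙xz r t (v c)) ⟩
  t * X + t * (r * v c)        ≡⟨ *-distribˡ-+ t X (r * v c) ⟨
  t * (X + r * v c)            ≡⟨ cong (t *_) X+rvc ⟩
  t * ((u + r) * V)            ≡⟨ *-assoc t (u + r) V ⟨
  t * (u + r) * V              ∎
  where
  open ≤-Reasoning
  V = sum v
  X = sum (λ a → if does (a Fin.≟ c) then u * v a else (u + r) * v a)
  X+rvc : X + r * v c ≡ (u + r) * V
  X+rvc = +-cancelʳ-≡ (u * v c) _ _ (begin-equality
    X + r * v c + u * v c          ≡⟨ +.xy∙z≈x∙zy X (r * v c) (u * v c) ⟩
    X + (u * v c + r * v c)        ≡⟨ cong (X +_) (*-distribʳ-+ (v c) u r) ⟨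
    X + (u + r) * v c              ≡⟨ sum-replace (λ a → u * v a) (λ a → (u + r) * v a) c ⟩
    sum (λ a → (u + r) * v a) + u * v c ≡⟨ cong (_+ u * v c) (*-distribˡ-sum (u + r) v) ⟨
    (u + r) * V + u * v c          ∎)

shortfall : ℕ → Subset n → Fin t → Coloring n t → ℕ
shortfall s f c χ = fewer s ∣ f ∩ colorClass χ c ∣

total-0 : ∀ n → total {t} n (λ _ → 0) ≡ 0
total-0 zero    = refl
total-0 {t} (suc n) = trans (sum-cong-≗ {t} λ _ → total-0 n) (sum-replicate-zero t)

-- Induction on the vertices, conditioning on the color of the first. On a vertex of the edge, color
-- `c` gives the smaller bound `u` and the other colors give `u + r`, while the conditional total of
-- `G` is largest at `c`. These opposite tendencies let `chebyshev` average the weights, and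
-- Pascal's recursion closes the induction.
harris : ∀ {q} s (f : Subset n) (c : Fin (suc q)) (G : Coloring n (suc q) → ℕ) → Favors f c G →
  total n (λ χ → shortfall s f c χ * G χ) * suc q ^ ∣ f ∣ ≤ binSum q ∣ f ∣ s * total n G
harris zero    []           c G fav = z≤n
harris {q = q} (suc s) []   c G fav = ≤-reflexive (trans (*-identityʳ (1 * G Func.[]))
  (cong (_* G Func.[]) (sym (binSum-full q {s = suc s} z<s))))
harris {n = suc n} {q = q} s (outside ∷ f) c G fav = begin
  sum X * suc q ^ ∣ f ∣             ≡⟨ *-distribʳ-sum (suc q ^ ∣ f ∣) X ⟩
  sum (λ a → X a * suc q ^ ∣ f ∣)   ≤⟨ sum-mono (λ a → harris s f c _ (favors-∷ a fav)) ⟩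
  sum (λ a → binSum q ∣ f ∣ s * total n (λ χ → G (a Func.∷ χ)))
                                    ≡⟨ *-distribˡ-sum (binSum q ∣ f ∣ s) v ⟨
  binSum q ∣ f ∣ s * total (suc n) G ∎
  where
  open ≤-Reasoning
  v : Fin (suc q) → ℕ
  v a = total n (λ χ → G (a Func.∷ χ))
  X : Fin (suc q) → ℕ
  X a = total n (λ χ → shortfall s f c χ * G (a Func.∷ χ))
harris {n = n} {q = q} zero (inside ∷ f) c G fav =
  ≤-trans (≤-reflexive (cong (_* suc q ^ ∣ inside ∷ f ∣) (total-0 {suc q} n))) z≤n
harris {n = suc n} {q = q} (suc s) (inside ∷ f) c G fav = +-cancelʳ-≤ (r * V) _ _ (begin
  sum X * (suc q * T) + r * V    ≡⟨ cong (_+ r * V) (x∙yz≈y∙xz (sum X) (suc q) T) ⟩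
  suc q * (sum X * T) + r * V    ≤⟨ +-monoˡ-≤ (r * V) (*-monoʳ-≤ (suc q)
                                      (≤-trans (≤-reflexive (*-distribʳ-sum T X)) (sum-mono step))) ⟩
  suc q * sum (λ a → if does (a Fin.≟ c) then u * v a else (u + r) * v a) + r * V
                                 ≤⟨ chebyshev v c u r v≤vc ⟩
  -- Of the `suc q` copies of `u + r` one gives up its `r`, which leaves exactly the right-hand side
  -- of Pascal's recursion.
  suc q * (u + r) * V            ≡⟨ cong (_* V) (+.xy∙z≈xz∙y u r (q * (u + r))) ⟩
  (u + q * (u + r) + r) * V      ≡⟨ *-distribʳ-+ V (u + q * (u + r)) r ⟩
  (u + q * (u + r)) * V + r * V  ≡⟨ cong (λ w → w * V + r * V) (binSum-pascal q ∣ f ∣ s) ⟨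
  binSum q (suc ∣ f ∣) (suc s) * V + r * V ∎)
  where
  open ≤-Reasoning
  v : Fin (suc q) → ℕ
  v a = total n (λ χ → G (a Func.∷ χ))
  V = sum v
  T = suc q ^ ∣ f ∣
  u = binSum q ∣ f ∣ s
  r = binTerm q ∣ f ∣ s
  X : Fin (suc q) → ℕ
  X a = total n (λ χ → shortfall (suc s) (inside ∷ f) c (a Func.∷ χ) * G (a Func.∷ χ))
  -- The first vertex lies in the edge, so giving it color `c` is an allowed recoloring.
  v≤vc : ∀ a → v a ≤ v c
  v≤vc a = total-mono n λ χ → fav λ where
    zero    → inj₂ (here , refl)
    (suc _) → inj₁ refl
  step : ∀ a → X a * T ≤ (if does (a Fin.≟ c) then u * v a else (u + r) * v a)
  -- Deciding `a ≟ c` makes `shortfall` compute: color `c` lowers the threshold to `s`, any other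
  -- keeps `suc s`, whose `binSum` is `u + r` by definition.
  step a with a Fin.≟ c
  ... | yes _ = harris s f c _ (favors-∷ a fav)
  ... | no  _ = harris (suc s) f c _ (favors-∷ a fav)

-- Color events and their conflicts.

∈-colorClass⁺ : ∀ (χ : Coloring n t) {v c} → χ v ≡ c → v ∈ₛ colorClass χ c
∈-colorClass⁺ χ {v} {c} χv≡c = lookup⇒[]= v _
  (trans (lookup∘tabulate _ v) (dec-true (χ v Fin.≟ c) χv≡c))

∈-colorClass⁻ : ∀ (χ : Coloring n t) {v c} → v ∈ₛ colorClass χ c → χ v ≡ c
∈-colorClass⁻ χ {v} {c} v∈
  with χ v Fin.≟ c | trans (sym (lookup∘tabulate (λ v → does (χ v Fin.≟ c)) v)) ([]=⇒lookup v∈)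
... | yes eq | _ = eq
... | no  _  | ()

Event : ℕ → ℕ → Set
Event n t = Subset n × Fin t

-- `g` may equal `f`: two colors compete for the vertices of a common edge, while no event conflicts
-- with itself.
Conflict : Event n t → Event n t → Set
Conflict (f , c) (g , c′) = Meet f g × c′ ≢ c

conflict? : (i j : Event n t) → Dec (Conflict i j)
conflict? (f , c) (g , c′) = nonempty? (f ∩ g) ×-dec ¬? (c′ Fin.≟ c)

enough : ℕ → Event n t → Coloring n t → ℕ
enough s (f , c) χ = atLeast s ∣ f ∩ colorClass χ c ∣

-- Moving vertices of f to the color c can only help g to see c, and leaves the
-- other colors of g alone when g is disjoint from f.
enough-favors : ∀ s {f : Subset n} {c : Fin t} {j} → ¬ Conflict (f , c) j → Favors f c (enough s j)
enough-favors s {f} {c} {g , c′} ¬conf {χ} {χ′} r = atLeast-mono s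
  (p⊆q⇒∣p∣≤∣q∣ {p = g ∩ colorClass χ c′} {g ∩ colorClass χ′ c′} λ {v} v∈ →
  let v∈g , v∈χ = x∈p∩q⁻ g (colorClass χ c′) v∈
  in x∈p∩q⁺ (v∈g , ∈-colorClass⁺ χ′ (recolored v∈g (∈-colorClass⁻ χ v∈χ) (r v))))
  where
  recolored : ∀ {v} → v ∈ₛ g → χ v ≡ c′ → _ → χ′ v ≡ c′
  recolored v∈g χv≡c′ (inj₁ χv≡χ′v) = trans (sym χv≡χ′v) χv≡c′
  recolored {v} v∈g χv≡c′ (inj₂ (v∈f , χ′v≡c)) with c′ Fin.≟ c
  ... | yes refl = χ′v≡c
  ... | no c′≢c  = contradiction ((v , x∈p∩q⁺ (v∈f , v∈g)) , c′≢c) ¬conf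

-- Counting the conflicts of one event.

module _ {a p} {A : Set a} {P : Pred A p} (_≟_ : DecidableEquality A) (P? : Decidable₁ P) where

  -- Without repetitions `x` occurs at most once. With an edge `f` as `x`, this passes from the
  -- other edges meeting `f` to all edges meeting `f`, which is the source of `d + 1`.
  filter-remove-≤ : ∀ x {xs} → Unique xs →
    length (filter P? xs) ≤ suc (length (filter (λ y → ¬? (y ≟ x) ×-dec P? y) xs))
  filter-remove-≤ x {[]} _ = z≤n
  filter-remove-≤ x {y ∷ ys} (y∉ys ∷ uniq) with y ≟ x
  ... | yes refl = ≤-trans length-∷-≤ (s≤s (≤-reflexive (cong length (filter-rest y∉ys))))
    where
    length-∷-≤ : length (filter P? (y ∷ ys)) ≤ suc (length (filter P? ys))
    length-∷-≤ with does (P? y)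
    ... | true  = ≤-refl
    ... | false = n≤1+n _
    filter-rest : ∀ {zs} → All (y ≢_) zs →
      filter P? zs ≡ filter (λ z → ¬? (z ≟ y) ×-dec P? z) zs
    filter-rest [] = refl
    filter-rest {z ∷ zs} (y≢z ∷ rest) with z ≟ y | does (P? z)
    ... | yes z≡y | _     = contradiction (sym z≡y) y≢z
    ... | no  _   | true  = cong (z ∷_) (filter-rest rest)
    ... | no  _   | false = filter-rest rest
  ... | no _ with does (P? y)
  ...   | true  = s≤s (filter-remove-≤ x uniq)
  ...   | false = filter-remove-≤ x uniq

otherColors-≤ : ∀ {q} (c : Fin (suc q)) →
  length (filter (λ c′ → ¬? (c′ Fin.≟ c)) (allFin (suc q))) ≤ q
otherColors-≤ {q} c = s≤s⁻¹ (≤-trans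
  (filter-notAll (λ c′ → ¬? (c′ Fin.≟ c)) (allFin (suc q))
    (lose (∈-allFin c) (λ c≢c → c≢c refl)))
  (≤-reflexive (length-tabulate (λ (i : Fin (suc q)) → i))))

conflicts-at : ∀ (f g : Subset n) (c : Fin t) cs →
  length (filter (conflict? (f , c)) (map (g ,_) cs)) ≡
  (if does (nonempty? (f ∩ g)) then length (filter (λ c′ → ¬? (c′ Fin.≟ c)) cs) else 0)
conflicts-at f g c [] with does (nonempty? (f ∩ g))
... | true  = refl
... | false = refl
conflicts-at f g c (c′ ∷ cs)
  with does (nonempty? (f ∩ g)) | does (c′ Fin.≟ c) | conflicts-at f g c cs
... | true  | true  | ih = ih
... | true  | false | ih = cong suc ih
... | false | _     | ih = ih

-- An edge of `E` that meets `f` carries at most `q` events of a color other than `c`, and the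
-- remaining edges carry no conflict. This supplies the factor t - 1.
conflicts-≤ : ∀ {q} (f : Subset n) (c : Fin (suc q)) E →
  length (filter (conflict? (f , c)) (cartesianProduct E (allFin (suc q)))) ≤
  length (filter (λ g → nonempty? (f ∩ g)) E) * q
conflicts-≤ f c [] = z≤n
conflicts-≤ {q = q} f c (g ∷ E) = begin
  length (filter P? (map (g ,_) colors ++ rest))
    ≡⟨ cong length (filter-++ P? (map (g ,_) colors) rest) ⟩
  length (filter P? (map (g ,_) colors) ++ filter P? rest)
    ≡⟨ length-++ (filter P? (map (g ,_) colors)) ⟩
  length (filter P? (map (g ,_) colors)) + length (filter P? rest)
    ≤⟨ +-mono-≤ (≤-reflexive (conflicts-at f g c colors)) (conflicts-≤ f c E) ⟩
  (if does (nonempty? (f ∩ g)) then others else 0) + meets * q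
    ≤⟨ perEdge ⟩
  length (filter (λ g → nonempty? (f ∩ g)) (g ∷ E)) * q ∎
  where
  open ≤-Reasoning
  colors = allFin (suc q)
  rest = cartesianProduct E colors
  P? = conflict? (f , c)
  meets = length (filter (λ g → nonempty? (f ∩ g)) E)
  others = length (filter (λ c′ → ¬? (c′ Fin.≟ c)) colors)
  perEdge : (if does (nonempty? (f ∩ g)) then others else 0) + meets * q ≤
    length (filter (λ g → nonempty? (f ∩ g)) (g ∷ E)) * q
  perEdge with does (nonempty? (f ∩ g))
  ... | true  = +-monoˡ-≤ (meets * q) (otherColors-≤ c)
  ... | false = ≤-refl

m*n>0⇒m>0 : ∀ m {n} → 0 < m * n → 0 < m
m*n>0⇒m>0 (suc m) _ = s≤s z≤n

m*n>0⇒n>0 : ∀ m {n} → 0 < m * n → 0 < n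
m*n>0⇒n>0 m {zero}  0<0 = subst (0 <_) (*-zeroʳ m) 0<0
m*n>0⇒n>0 m {suc n} _   = s≤s z≤n

-- The local lemma applied to color events.

module ColorEvents {n : ℕ} (q s : ℕ) (E : List (Subset n)) where

  open LocalLemma {Coloring n (suc q)} (total n) (total-+ n) (total-mono n)
    (λ (f , c) → shortfall s f c) (enough s)
    (λ (f , c) χ → fewer+atLeast s ∣ f ∩ colorClass χ c ∣)
    conflict? (λ (f , _) → f ∈ E) public

  avoid-favors : ∀ {f c L} → All (λ j → ¬ Conflict (f , c) j) L → Favors f c (avoid L)
  avoid-favors []             r = ≤-refl
  avoid-favors (¬conf ∷ rest) r = *-mono-≤ (enough-favors s ¬conf r) (avoid-favors rest r)

  -- `harris` gives the bound for the true size of `f`; `binSum-antitone` then replaces that size by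
  -- `k`.
  lopsided : ∀ {k} → (∀ f → f ∈ E → k ≤ ∣ f ∣) → Lopsided (binSum q k s) (suc q ^ k)
  lopsided {k} large (f , c) L f∈E free = *-cancelʳ-≤ _ _ (r ^ m) {{m^n≢0 r m}} (begin
    x * r ^ k * r ^ m           ≡⟨ xy∙z≈xz∙y x (r ^ k) (r ^ m) ⟩
    x * r ^ m * r ^ k           ≤⟨ *-monoˡ-≤ (r ^ k) (harris s f c (avoid L) (avoid-favors free)) ⟩
    binSum q m s * N * r ^ k    ≡⟨ xy∙z≈xz∙y (binSum q m s) N (r ^ k) ⟩
    binSum q m s * r ^ k * N    ≤⟨ *-monoˡ-≤ N (binSum-antitone q s (large f f∈E)) ⟩
    binSum q k s * r ^ m * N    ≡⟨ xy∙z≈xz∙y (binSum q k s) (r ^ m) N ⟩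
    binSum q k s * N * r ^ m    ∎)
    where
    open ≤-Reasoning
    r = suc q
    m = ∣ f ∣
    N = total n (avoid L)
    x = total n (λ χ → shortfall s f c χ * avoid L χ)

  avoid-positive⇒enough : ∀ χ L {i} → 0 < avoid L χ → i ∈ L → 0 < enough s i χ
  avoid-positive⇒enough χ (i ∷ L) 0<a (here refl) = m*n>0⇒m>0 (enough s i χ) 0<a
  avoid-positive⇒enough χ (i ∷ L) 0<a (there i∈)  =
    avoid-positive⇒enough χ L (m*n>0⇒n>0 (enough s i χ) 0<a) i∈

theorem5 : ∀ {n} (H : Hypergraph n) (k d : ℕ) →
    (∀ f → f ∈ edges H → k ≤ ∣ f ∣) →
    (∀ f → f ∈ edges H → otherMeetingCount H f ≤ d) →
    ∀ t s .{{_ : NonZero t}} → 2 ≤ t → 1 ≤ s → s * t ≤ k →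
    e *ℝ fromℚ (binomialTail k s t) *ℝ fromℚ (fromℕ ((d + 1) * (t ∸ 1) + 1)) ≤ℝ fromℚ 1ℚ →
    ∃[ χ ] IsColoring H t s χ
theorem5 {n} H k d large few (suc q) s (s≤s 1≤q) 1≤s st≤k cond =
  χ , λ f f∈E c → atLeast-positive s _
    (avoid-positive⇒enough χ events (proj₂ found) (∈-cartesianProduct⁺ f∈E (∈-allFin c)))
  where
  -- `D` bounds the conflicts of one event, and `D + 1` is the last factor of the hypothesis. It is
  -- nonzero since `2 ≤ t` makes `q` positive.
  D = (d + 1) * q
  instance
    _ : NonZero D
    _ = m*n≢0 (d + 1) q {{>-nonZero (m≤n+m 1 d)}} {{>-nonZero 1≤q}}
    _ : NonZero (suc q ^ k)
    _ = m^n≢0 (suc q) k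
  open ColorEvents q s (edges H)
  events = cartesianProduct (edges H) (allFin (suc q))
  s≤k : s ≤ k
  s≤k = ≤-trans (m≤m*n s (suc q)) st≤k
  small : binSum q k s * suc D ^ suc D ≤ suc q ^ k * D ^ D
  small = condition⇒small q k s D s≤k (subst
    (λ m → e *ℝ fromℚ (binomialTail k s (suc q)) *ℝ fromℚ (fromℕ m) ≤ℝ fromℚ 1ℚ) (+-comm D 1) cond)
  sparse : Sparse D events
  sparse = All.tabulate (λ i∈ → proj₁ (∈-cartesianProduct⁻ (edges H) _ i∈)) , λ (f , c) f∈E →
    -- At most `d` other edges meet `f`, so with `f` at most `d + 1`, each contributing at most `q`
    -- conflicts.
    ≤-trans (conflicts-≤ f c (edges H)) (*-monoˡ-≤ q (≤-trans
      (filter-remove-≤ (≡-dec _≟ᵇ_) (λ g → nonempty? (f ∩ g)) f (unique H))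
      (≤-trans (s≤s (few f f∈E)) (≤-reflexive (+-comm 1 d)))))
  found : ∃[ χ ] 0 < avoid events χ
  -- A positive number of colorings avoids all events, so one exists.
  found = total-positive n (avoid events)
    (avoid-positive {binSum q k s} (lopsided large) small (total-1 n) events sparse)
  χ = proj₁ found
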